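{- Let $\xi=(L^\xi,\Delta_0^\xi,B^\xi,d,G)$ be a generic configuration. There exists no $\xi$-Conventional axiom system $\alpha$ that can prove the validity of the translational reflection principle for any translation mapping $T$. In other words, for a $\xi$-Conventional axiom system $\alpha$ there is no algorithm $T$ that maps $\Pi_1^\xi$ sentences $\Psi$ onto alternate $\Pi_1^\xi$ sentences $\Psi^T$, with $\Psi^T$ equivalent to $\Psi$ in the Standard-M model, such that $\alpha$ can verify $$\forall p\ [\ \mathrm{Prf}_{\alpha,d}(\lceil\Psi\rceil,p)\Rightarrow\Psi^T\ ]$$ for every $\Pi_1^\xi$ sentence $\Psi$.
   Context: **Generic configurations.** Standard-M is the standard model of the natural numbers. A generic configuration $\xi$ is a 5-tuple $(L^\xi,\Delta_0^\xi,B^\xi,d,G)$ where: (1) $L^\xi$ is a language with symbols for $0,1,2,=,\le$ and $\mathrm{Maximum}(x,y)$, and enough function and constant symbols that every integer $k$ is the value of some term $T_k$. (2) $\Delta_0^\xi$ is a fixed class of fully bounded $L^\xi$-formulas (all quantifiers have the form $\exists v\le T$ or $\forall v\le T$ with $T$ a term), closed under negation, and rich enough to contain two formulas $\mathrm{Add}(x,y,z)$ and $\mathrm{Mult}(x,y,z)$ defining the graphs of addition and multiplication. Every $\Delta_0^\xi$ formula is both $\Pi_0^\xi$ and $\Sigma_0^\xi$; for $n\ge1$ a formula is $\Pi_n^\xi$ (resp. $\Sigma_n^\xi$) iff it can be written $\forall v_1\cdots\forall v_k\,\Phi$ with $\Phi\in\Sigma_{n-1}^\xi$ (resp. $\exists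 v_1\cdots\exists v_k\,\Phi$ with $\Phi\in\Pi_{n-1}^\xi$); $\Delta_0^\xi$ sentences count as both $\Pi_1^\xi$ and $\Sigma_1^\xi$. (3) $B^\xi$ (the base axiom system) is an axiom system whose axioms are true in Standard-M and which is $\Sigma_1^\xi$-complete: it proves every true $\Sigma_1^\xi$ sentence and refutes every false $\Pi_1^\xi$ sentence. (4) $d$ is a deduction method, conventional enough to satisfy the indirect-implication property associated with Gödel's Completeness Theorem: whether or not modus ponens is built in, whenever it can prove $X$, $Y$ and $(X\wedge Y)\to Z$, it can prove $Z$ (possibly by a much longer proof). (5) $G$ is a method for encoding the Gödel numbers of proofs. Proofs are identified with their Gödel numbers $p$. **$\xi$-Conventional systems.** An axiom system $\alpha$ is $\xi$-Conventional iff: (a) $\alpha$ is unable to verify (prove) its own consistency under $\xi$'s deduction method $d$; and (b) $\alpha$ is an extension of $B^\xi$ (hence it is $\Sigma_1^\xi$-complete: it proves every $\Sigma_1^\xi$ sentence true in Standard-M and refutes every false $\Pi_1^\xi$ sentence). **Notation.** $\lceil\Psi\rceil$ is the Gödel number of $\Psi$, and $\mathrm{Prf}_{\alpha,d}(t,p)$ is the formula stating that $p$ is a proof of $t$ from $\alpha$ using the deduction method $d$.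
   Formalization: Consistency of α is the sentence that no p is a proof of 0=1, and the class Δ₀ is additionally required to contain 0=1 (otherwise the claim can fail); the deduction method is taken to be sound and to prove every logically valid sentence. -}

module Defs where

open import Data.Empty using (⊥)
open import Data.Fin using (Fin; zero; suc)
open import Data.Nat using (ℕ; zero; suc; _+_; _*_; _≤_; _<_; _⊔_)
open import Data.Product using (Σ; ∃; ∃₂; _×_; _,_; proj₁)
open import Data.Vec using (Vec; []; _∷_; lookup)
open import Function.Bundles using (_⇔_)
open import Function.Definitions using (Injective)
open import Level using (0ℓ) renaming (suc to lsuc)
open import Relation.Binary.PropositionalEquality using (_≡_)
open import Relation.Nullary using (¬_)
open import Relation.Nullary.Negation using (Stable)
open import Relation.Unary using (Pred; _∈_)

record Language : Set₁ where
  field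
    Func Rel : ℕ → Set
    zeroˢ oneˢ twoˢ : Func 0
    maximumˢ : Func 2
    leqˢ : Rel 2

-- Well-scoped de Bruijn syntax of first-order logic with equality over a
-- language.  The primitive connectives are ⊥, ∧, ⇒ and ∀; with the stability
-- requirement on structures below, Tarski truth is then classical.

module Syntax (L : Language) where
  open Language L

  infix  8 _≐_ _≤̇_
  infix  7 ¬̇_
  infixr 6 _∧̇_
  infixr 5 _⇒̇_
  infix  4 ∀̇_ ∃̇_

  data Term (n : ℕ) : Set where
    var : Fin n → Term n
    fun : ∀ {k} → Func k → Vec (Term n) k → Term n

  data Formula (n : ℕ) : Set where
    _≐_  : Term n → Term n → Formula n
    rel  : ∀ {k} → Rel k → Vec (Term n) k → Formula n
    ⊥̇    : Formula n
    _∧̇_  : Formula n → Formula n → Formula n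
    _⇒̇_  : Formula n → Formula n → Formula n
    ∀̇_   : Formula (suc n) → Formula n

  Sentence : Set
  Sentence = Formula 0

  ¬̇_ : ∀ {n} → Formula n → Formula n
  ¬̇ φ = φ ⇒̇ ⊥̇

  ∃̇_ : ∀ {n} → Formula (suc n) → Formula n
  ∃̇ φ = ¬̇ (∀̇ ¬̇ φ)

  _≤̇_ : ∀ {n} → Term n → Term n → Formula n
  s ≤̇ t = rel leqˢ (s ∷ t ∷ [])

  0=1 : Sentence
  0=1 = fun zeroˢ [] ≐ fun oneˢ []

  ∀̇^ : ∀ {n} k → Formula (k + n) → Formula n
  ∀̇^ zero    φ = φ
  ∀̇^ (suc k) φ = ∀̇^ k (∀̇ φ)

  ∃̇^ : ∀ {n} k → Formula (k + n) → Formula n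
  ∃̇^ zero    φ = φ
  ∃̇^ (suc k) φ = ∃̇^ k (∃̇ φ)

  Sub : ℕ → ℕ → Set
  Sub m n = Fin m → Term n

  mutual
    substᵗ : ∀ {m n} → Sub m n → Term m → Term n
    substᵗ σ (var i)    = σ i
    substᵗ σ (fun f ts) = fun f (substᵗˢ σ ts)

    substᵗˢ : ∀ {m n k} → Sub m n → Vec (Term m) k → Vec (Term n) k
    substᵗˢ σ []       = []
    substᵗˢ σ (t ∷ ts) = substᵗ σ t ∷ substᵗˢ σ ts

  weakenᵗ : ∀ {n} → Term n → Term (suc n)
  weakenᵗ = substᵗ (λ i → var (suc i))

  lift : ∀ {m n} → Sub m n → Sub (suc m) (suc n)
  lift σ zero    = var zero
  lift σ (suc i) = weakenᵗ (σ i)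

  subst : ∀ {m n} → Sub m n → Formula m → Formula n
  subst σ (s ≐ t)    = substᵗ σ s ≐ substᵗ σ t
  subst σ (rel r ts) = rel r (substᵗˢ σ ts)
  subst σ ⊥̇          = ⊥̇
  subst σ (φ ∧̇ ψ)    = subst σ φ ∧̇ subst σ ψ
  subst σ (φ ⇒̇ ψ)    = subst σ φ ⇒̇ subst σ ψ
  subst σ (∀̇ φ)      = ∀̇ subst (lift σ) φ

  weaken : ∀ {n} → Formula n → Formula (suc n)
  weaken = subst (λ i → var (suc i))

  -- The bounding term lives outside the scope of the variable it bounds.
  data FullyBounded {n : ℕ} : Formula n → Set where
    eqᵇ  : ∀ s t → FullyBounded (s ≐ t)
    relᵇ : ∀ {k} (r : Rel k) ts → FullyBounded (rel r ts)
    ⊥ᵇ   : FullyBounded ⊥̇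
    ∧ᵇ   : ∀ {φ ψ} → FullyBounded φ → FullyBounded ψ → FullyBounded (φ ∧̇ ψ)
    ⇒ᵇ   : ∀ {φ ψ} → FullyBounded φ → FullyBounded ψ → FullyBounded (φ ⇒̇ ψ)
    ∀ᵇ   : ∀ t {φ} → FullyBounded φ →
           FullyBounded (∀̇ (var zero ≤̇ weakenᵗ t ⇒̇ φ))
    ∃ᵇ   : ∀ t {φ} → FullyBounded φ →
           FullyBounded (∃̇ (var zero ≤̇ weakenᵗ t ∧̇ φ))

  -- Nonemptiness of A is automatic, since the language has constants.
  record Structure (A : Set) : Set₁ where
    field
      ⟦_⟧ᶠ     : ∀ {k} → Func k → Vec A k → A
      ⟦_⟧ʳ     : ∀ {k} → Rel k → Vec A k → Set
      ≡-stable : ∀ (x y : A) → Stable (x ≡ y)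
      ʳ-stable : ∀ {k} (r : Rel k) xs → Stable (⟦ r ⟧ʳ xs)

  module _ {A : Set} (M : Structure A) where
    open Structure M

    mutual
      eval : ∀ {n} → Vec A n → Term n → A
      eval ρ (var i)    = lookup ρ i
      eval ρ (fun f ts) = ⟦ f ⟧ᶠ (evals ρ ts)

      evals : ∀ {n k} → Vec A n → Vec (Term n) k → Vec A k
      evals ρ []       = []
      evals ρ (t ∷ ts) = eval ρ t ∷ evals ρ ts

    Sat : ∀ {n} → Vec A n → Formula n → Set
    Sat ρ (s ≐ t)    = eval ρ s ≡ eval ρ t
    Sat ρ (rel r ts) = ⟦ r ⟧ʳ (evals ρ ts)
    Sat ρ ⊥̇          = ⊥
    Sat ρ (φ ∧̇ ψ)    = Sat ρ φ × Sat ρ ψ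
    Sat ρ (φ ⇒̇ ψ)    = Sat ρ φ → Sat ρ ψ
    Sat ρ (∀̇ φ)      = ∀ a → Sat (a ∷ ρ) φ

  infix 3 _⊨_ _⊩_

  _⊨_ : ∀ {A} → Structure A → Sentence → Set
  M ⊨ φ = Sat M [] φ

  Axioms : Set₁
  Axioms = Pred Sentence 0ℓ

  _⊩_ : Axioms → Sentence → Set₁
  α ⊩ φ = ∀ {A} (M : Structure A) → (∀ ψ → ψ ∈ α → M ⊨ ψ) → M ⊨ φ

  Valid : Sentence → Set₁
  Valid φ = ∀ {A} (M : Structure A) → M ⊨ φ

  record IsStandard (M : Structure ℕ) : Set where
    open Structure M
    field
      zero-std    : ⟦ zeroˢ ⟧ᶠ [] ≡ 0
      one-std     : ⟦ oneˢ ⟧ᶠ [] ≡ 1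
      two-std     : ⟦ twoˢ ⟧ᶠ [] ≡ 2
      maximum-std : ∀ x y → ⟦ maximumˢ ⟧ᶠ (x ∷ y ∷ []) ≡ x ⊔ y
      leq-std     : ∀ x y → ⟦ leqˢ ⟧ʳ (x ∷ y ∷ []) ⇔ x ≤ y

  -- Soundness and completeness express that d is a deduction method for
  -- classical first-order logic.  Completeness is asked only for logically
  -- valid sentences; reasoning from axioms goes through `indirect`.
  record DeductionMethod : Set₁ where
    field
      Proof   : Set
      IsProof : Axioms → Sentence → Proof → Set

    infix 3 _⊢_
    _⊢_ : Axioms → Sentence → Set
    α ⊢ φ = ∃ λ π → IsProof α φ π

    field
      axiom    : ∀ {α φ} → φ ∈ α → α ⊢ φ
      sound    : ∀ {α φ} → α ⊢ φ → α ⊩ φ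
      complete : ∀ {α φ} → Valid φ → α ⊢ φ
      indirect : ∀ {α X Y Z} → α ⊢ X → α ⊢ Y → α ⊢ X ∧̇ Y ⇒̇ Z → α ⊢ Z

  record Encoding (d : DeductionMethod) : Set where
    open DeductionMethod d
    field
      ⌜_⌝              : Sentence → ℕ
      ⌜⌝-injective     : Injective _≡_ _≡_ ⌜_⌝
      encode           : Proof → ℕ
      encode-injective : Injective _≡_ _≡_ encode

  module Hierarchy (Δ₀ : ∀ {n} → Formula n → Set) where
    mutual
      IsΠ : ℕ → ∀ {n} → Formula n → Set
      IsΠ zero    φ = Δ₀ φ
      IsΠ (suc m) φ = ∃₂ λ k Φ → IsΣ m Φ × φ ≡ ∀̇^ k Φ

      IsΣ : ℕ → ∀ {n} → Formula n → Set
      IsΣ zero    φ = Δ₀ φ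
      IsΣ (suc m) φ = ∃₂ λ k Φ → IsΠ m Φ × φ ≡ ∃̇^ k Φ

record GenericConfiguration : Set₁ where
  field
    L : Language
  open Syntax L public

  field
    Standard-M : Structure ℕ
    standard   : IsStandard Standard-M
    numeral    : ∀ k → ∃ λ (T : Term 0) → eval Standard-M [] T ≡ k

    Δ₀           : ∀ {n} → Formula n → Set
    Δ₀-bounded   : ∀ {n} {φ : Formula n} → Δ₀ φ → FullyBounded φ
    Δ₀-¬         : ∀ {n} {φ : Formula n} → Δ₀ φ → Δ₀ (¬̇ φ)
    -- The absurdity in terms of which consistency is expressed is Δ₀.
    Δ₀-0=1       : Δ₀ 0=1
    Add Mult     : Formula 3
    Add-Δ₀       : Δ₀ Add
    Mult-Δ₀      : Δ₀ Mult
    Add-defines  : ∀ x y z → Sat Standard-M (x ∷ y ∷ z ∷ []) Add ⇔ x + y ≡ z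
    Mult-defines : ∀ x y z → Sat Standard-M (x ∷ y ∷ z ∷ []) Mult ⇔ x * y ≡ z
  open Hierarchy Δ₀ public

  field
    d : DeductionMethod
  open DeductionMethod d public

  field
    B            : Axioms
    B-true       : ∀ φ → φ ∈ B → Standard-M ⊨ φ
    B-Σ₁-proves  : ∀ φ → IsΣ 1 φ → Standard-M ⊨ φ → B ⊢ φ
    B-Π₁-refutes : ∀ φ → IsΠ 1 φ → ¬ (Standard-M ⊨ φ) → B ⊢ ¬̇ φ

    G : Encoding d
  open Encoding G public

  T : ℕ → Term 0
  T k = proj₁ (numeral k)

-- Partial recursive functions, by graph.

data Program : ℕ → Set where
  zer : Program 0
  suk : Program 1
  prj : ∀ {n} → Fin n → Program n
  cmp : ∀ {m n} → Program m → (Fin m → Program n) → Program n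
  rec : ∀ {n} → Program n → Program (suc (suc n)) → Program (suc n)
  min : ∀ {n} → Program (suc n) → Program n

infix 4 _⟨_⟩⇓_

data _⟨_⟩⇓_ : ∀ {n} → Program n → Vec ℕ n → ℕ → Set where
  ⇓zer : zer ⟨ [] ⟩⇓ 0
  ⇓suk : ∀ {x} → suk ⟨ x ∷ [] ⟩⇓ suc x
  ⇓prj : ∀ {n} {xs : Vec ℕ n} i → prj i ⟨ xs ⟩⇓ lookup xs i
  ⇓cmp : ∀ {m n} {f : Program m} {g : Fin m → Program n} {xs y} (ys : Vec ℕ m) →
         (∀ i → g i ⟨ xs ⟩⇓ lookup ys i) → f ⟨ ys ⟩⇓ y → cmp f g ⟨ xs ⟩⇓ y
  ⇓rec-zero : ∀ {n} {f : Program n} {g xs y} →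
              f ⟨ xs ⟩⇓ y → rec f g ⟨ 0 ∷ xs ⟩⇓ y
  ⇓rec-suc  : ∀ {n} {f : Program n} {g xs x r y} →
              rec f g ⟨ x ∷ xs ⟩⇓ r → g ⟨ x ∷ r ∷ xs ⟩⇓ y →
              rec f g ⟨ suc x ∷ xs ⟩⇓ y
  ⇓min : ∀ {n} {f : Program (suc n)} {xs y} →
         f ⟨ y ∷ xs ⟩⇓ 0 → (∀ z → z < y → ∃ λ k → f ⟨ z ∷ xs ⟩⇓ suc k) →
         min f ⟨ xs ⟩⇓ y

module _ (ξ : GenericConfiguration) where
  open GenericConfiguration ξ

  -- An axiom system comes with its proof predicate.  In `Prf`, variable 0 is
  -- the Gödel number t of the theorem and variable 1 that of the proof p.
  record AxiomSystem : Set₁ where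
    field
      axioms      : Axioms
      Prf         : Formula 2
      Prf-correct : ∀ t p → Sat Standard-M (t ∷ p ∷ []) Prf ⇔
                    (∃₂ λ Ψ π → ⌜ Ψ ⌝ ≡ t × encode π ≡ p × IsProof axioms Ψ π)

  module _ (α : AxiomSystem) where
    open AxiomSystem α

    Proves : Sentence → Set
    Proves φ = axioms ⊢ φ

    -- Prf(⌜Ψ⌝, p), with p the only free variable.
    PrfOf : Sentence → Formula 1
    PrfOf Ψ = subst σ Prf
      where
      σ : Sub 2 1
      σ zero       = substᵗ (λ ()) (T ⌜ Ψ ⌝)
      σ (suc zero) = var zero

    Consistency : Sentence
    Consistency = ∀̇ ¬̇ PrfOf 0=1

    record Conventional : Set where
      field
        unverified : ¬ Proves Consistency
        extends-B  : ∀ φ → B ⊢ φ → Proves φ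

    Reflection : Sentence → Sentence → Sentence
    Reflection Ψ Ψ′ = ∀̇ (PrfOf Ψ ⇒̇ weaken Ψ′)

  Π₁Sentence : Set
  Π₁Sentence = Σ Sentence (IsΠ 1)

  record IsTranslation (_ᵀ : Π₁Sentence → Π₁Sentence) : Set where
    field
      program    : Program 1
      computes   : ∀ Ψ → program ⟨ ⌜ proj₁ Ψ ⌝ ∷ [] ⟩⇓ ⌜ proj₁ (Ψ ᵀ) ⌝
      equivalent : ∀ Ψ → (Standard-M ⊨ proj₁ Ψ) ⇔ (Standard-M ⊨ proj₁ (Ψ ᵀ))

{-# OPTIONS --safe #-}
-- Reflect on the Δ₀ (hence Π₁) sentence 0=1.  Its translation is a false Π₁
-- sentence, so B, and with it α, refutes it.  Together with the reflection
-- principle for 0=1 this makes α prove that no p is a proof of 0=1, which is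
-- its own consistency.
module Submission where

open import Defs
open import Data.Fin using (zero; suc)
open import Data.Product using (∃; _×_; _,_; proj₁; proj₂)
open import Data.Product.Function.NonDependent.Propositional using (_×-⇔_)
open import Data.Vec using (Vec; []; _∷_; lookup)
open import Function.Bundles using (_⇔_; mk⇔; module Equivalence)
open import Function.Construct.Identity using (⇔-id)
open import Function.Related.TypeIsomorphisms using (→-cong-⇔)
open import Relation.Binary.PropositionalEquality
  using (_≡_; refl; sym; trans; cong; cong₂)
open import Relation.Nullary using (¬_)

open Equivalence using (to; from)

≡-cong-⇔ : {A : Set} {x x′ y y′ : A} → x ≡ x′ → y ≡ y′ → (x ≡ y) ⇔ (x′ ≡ y′)
≡-cong-⇔ refl refl = ⇔-id _

module _ {L : Language} where
  open Syntax L

  module _ {A : Set} (M : Structure A) where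
    open Structure M

    -- A pointwise relation rather than a computed environment: under a binder, `ρ′` then extends to
    -- `a ∷ ρ′` on the nose.
    _⊢_≗_ : ∀ {m n} → Vec A n → Sub m n → Vec A m → Set
    ρ ⊢ σ ≗ ρ′ = ∀ i → eval M ρ (σ i) ≡ lookup ρ′ i

    mutual
      eval-substᵗ : ∀ {m n} {ρ : Vec A n} {σ : Sub m n} {ρ′} → ρ ⊢ σ ≗ ρ′ →
                    ∀ t → eval M ρ (substᵗ σ t) ≡ eval M ρ′ t
      eval-substᵗ eq (var i)    = eq i
      eval-substᵗ eq (fun f ts) = cong ⟦ f ⟧ᶠ (evals-substᵗˢ eq ts)

      evals-substᵗˢ : ∀ {m n k} {ρ : Vec A n} {σ : Sub m n} {ρ′} → ρ ⊢ σ ≗ ρ′ →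
                      ∀ (ts : Vec (Term m) k) →
                      evals M ρ (substᵗˢ σ ts) ≡ evals M ρ′ ts
      evals-substᵗˢ eq []       = refl
      evals-substᵗˢ eq (t ∷ ts) = cong₂ _∷_ (eval-substᵗ eq t) (evals-substᵗˢ eq ts)

    lift-≗ : ∀ {m n} {ρ : Vec A n} {σ : Sub m n} {ρ′} → ρ ⊢ σ ≗ ρ′ →
             ∀ a → (a ∷ ρ) ⊢ lift σ ≗ (a ∷ ρ′)
    lift-≗         eq a zero    = refl
    -- Weakening is itself a substitution: evaluated in `a ∷ ρ`, it satisfies `_⊢_≗_` for `ρ` by
    -- computation.
    lift-≗ {σ = σ} eq a (suc i) = trans (eval-substᵗ (λ _ → refl) (σ i)) (eq i)

    Sat-subst : ∀ {m n} {ρ : Vec A n} {σ : Sub m n} {ρ′} → ρ ⊢ σ ≗ ρ′ →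
                ∀ φ → Sat M ρ (subst σ φ) ⇔ Sat M ρ′ φ
    Sat-subst eq (s ≐ t)    = ≡-cong-⇔ (eval-substᵗ eq s) (eval-substᵗ eq t)
    Sat-subst {ρ = ρ} {σ} {ρ′} eq (rel r ts)
      rewrite evals-substᵗˢ {ρ = ρ} {σ} {ρ′} eq ts = ⇔-id _
    Sat-subst eq ⊥̇          = ⇔-id _
    Sat-subst eq (φ ∧̇ ψ)    = Sat-subst eq φ ×-⇔ Sat-subst eq ψ
    Sat-subst eq (φ ⇒̇ ψ)    = →-cong-⇔ (Sat-subst eq φ) (Sat-subst eq ψ)
    Sat-subst eq (∀̇ φ)      =
      mk⇔ (λ h a → to   (Sat-subst (lift-≗ eq a) φ) (h a))
          (λ h a → from (Sat-subst (lift-≗ eq a) φ) (h a))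

    Sat-weaken : ∀ {n} a (ρ : Vec A n) φ → Sat M (a ∷ ρ) (weaken φ) ⇔ Sat M ρ φ
    Sat-weaken a ρ = Sat-subst (λ _ → refl)

  -- Since `ψ` does not mention the quantified variable, any `a` satisfying `φ` would make `ψ` true
  -- outright. The form `X ∧̇ Y ⇒̇ Z` is the one that `indirect` consumes.
  modus-tollens-valid : ∀ (φ : Formula 1) ψ →
                        Valid ((∀̇ (φ ⇒̇ weaken ψ)) ∧̇ ¬̇ ψ ⇒̇ (∀̇ ¬̇ φ))
  modus-tollens-valid φ ψ M (φ⇒ψ , ¬ψ) a φa = ¬ψ (to (Sat-weaken M a [] ψ) (φ⇒ψ a φa))

module _ (ξ : GenericConfiguration) where
  open GenericConfiguration ξ
  open IsStandard standard

  0=1-Π₁ : Π₁Sentence ξ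
  -- An empty block of quantifiers over a Δ₀ matrix.
  0=1-Π₁ = 0=1 , 0 , 0=1 , Δ₀-0=1 , refl

  0=1-false : ¬ (Standard-M ⊨ 0=1)
  0=1-false h with () ← trans (sym zero-std) (trans h one-std)

  module _ (α : AxiomSystem ξ) where

    -- `Consistency` unfolds to `∀̇ ¬̇ PrfOf 0=1`, the conclusion of modus tollens for `PrfOf 0=1`.
    -- The implication is logically valid, so `complete` proves it and `indirect` detaches it.
    reflection-refutation⇒consistency : ∀ ψ → Proves ξ α (Reflection ξ α 0=1 ψ) →
                                        Proves ξ α (¬̇ ψ) → Proves ξ α (Consistency ξ α)
    reflection-refutation⇒consistency ψ reflects refutes =
      indirect reflects refutes
        (complete (modus-tollens-valid (PrfOf ξ α 0=1) ψ))

theoremE1 : (ξ : GenericConfiguration) (α : AxiomSystem ξ) → Conventional ξ α →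
    ¬ (∃ λ (_ᵀ : Π₁Sentence ξ → Π₁Sentence ξ) → IsTranslation ξ _ᵀ ×
    ((Ψ : Π₁Sentence ξ) → Proves ξ α (Reflection ξ α (proj₁ Ψ) (proj₁ (Ψ ᵀ)))))
theoremE1 ξ α conventional (_ᵀ , translation , reflects) =
  unverified (reflection-refutation⇒consistency ξ α ψ (reflects (0=1-Π₁ ξ))
    (extends-B _ (B-Π₁-refutes ψ (proj₂ (0=1-Π₁ ξ ᵀ)) ψ-false)))
  where
  open GenericConfiguration ξ
  open Conventional conventional
  open IsTranslation translation

  ψ : Sentence
  ψ = proj₁ (0=1-Π₁ ξ ᵀ)

  ψ-false : ¬ (Standard-M ⊨ ψ)
  -- Truth of the translation would pass back along `equivalent` to `0=1`.
  ψ-false h = 0=1-false ξ (from (equivalent (0=1-Π₁ ξ)) h)
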